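{- Suppose that $\Gamma$ is a consistent set of s-formulas in $\mathcal{F}_2$, $\phi$ is an s-formula in $\mathcal{F}_2$, and every frame that satisfies $\Gamma$ satisfies $\phi$. Then there is a derivation of $\phi$ from $\Gamma$ using the rules (I), (W), (HS), and (N) of the deductive system for $\mathcal{F}_2$.
   Context: Fix an infinite (possibly uncountable) set $\Sigma$ of propositional variables. The fragment $\mathcal{F}_2$ consists of all formal expressions (s-formulas) $A\prec Y$ (strict implication) and $A\not\prec Y$ (strict nonimplication), where $A$ is a nonempty finite conjunction of propositional variables and $Y$ is a single propositional variable; $\prec$ and $\not\prec$ are two formal symbols. For conjunctions of variables $A$ and $B$, $A\land B$ denotes the conjunction obtained by inserting $\land$ between $A$ and $B$ (parenthesization is disregarded, so a conjunction amounts to a finite list of variables). A valuation is a function $w:\Sigma\to\{T,F\}$, extended in the usual way to conjunctions. A frame is a nonempty set of valuations. A frame $R$ satisfies $A \prec Y$ if for every $w\in R$, $w(A)=F$ or $w(Y)=T$. A frame $R$ satisfies $A\not\prec Y$ if there is some $w\in R$ with $w(A)=T$ and $w(Y)=F$. A frame satisfies a set $\Gamma$ of s-formulas if it satisfies every member. $\Gamma$ is consistent if some frame satisfies it. The deductive system for $\mathcal{F}_2$ consists of the following rule schemes, where $A,B$ range over nonempty conjunctions of propositional variables (except that $B$ may be empty in (HS)) and $X,Y,Z$ over propositional variables: - (I) Deduce $X\prec X$ (no premises). - (W) From $A\prec Y$, deduce $B\prec Y$, where $B$ is any conjunction such that every conjunct of $A$ is also a conjunct of $B$. - (HS) From $X\land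 B\prec Y$ and $A\prec X$, deduce $A\land B\prec Y$. - (N) From $A\not\prec X$, $A\land Z\prec X$, and $A\prec Y$ for each conjunct $Y$ of $B$, deduce $B\not\prec Z$. A derivation of $\phi$ from $\Gamma$ is a finite derivation of $\phi$ from members of $\Gamma$ using these rules. -}

module Defs where

open import Level using (Level; suc)
open import Data.Bool.Base using (Bool; true; false; _∧_)
open import Data.Fin.Base using (Fin)
open import Data.List.Base using (List; []; _∷_)
open import Data.List.NonEmpty.Base using (List⁺; _∷_; [_]; toList; map; foldr₁; _⁺++_)
open import Data.List.NonEmpty.Relation.Unary.All using (All)
open import Data.List.Relation.Binary.Subset.Propositional using (_⊆_)
open import Data.Nat.Base using (ℕ)
open import Data.Product.Base using (∃; _×_)
open import Data.Sum.Base using (_⊎_)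
open import Function.Bundles using (_↔_)
open import Relation.Binary.PropositionalEquality.Core using (_≡_)
open import Relation.Nullary.Negation.Core using (¬_)
open import Relation.Unary using (Pred; Satisfiable)

private
  variable
    ℓ : Level

Infinite : Set ℓ → Set ℓ
Infinite V = ¬ (∃ λ (n : ℕ) → V ↔ Fin n)

Conj : Set ℓ → Set ℓ
Conj V = List⁺ V

infix 6 _≺_ _⊀_

data SFormula (V : Set ℓ) : Set ℓ where
  _≺_ : Conj V → V → SFormula V
  _⊀_ : Conj V → V → SFormula V

Valuation : Set ℓ → Set ℓ
Valuation V = V → Bool

⟦_⟧ : {V : Set ℓ} → Conj V → Valuation V → Bool
⟦ A ⟧ w = foldr₁ _∧_ (map w A)

-- Sets of formulas, and of valuations, are predicates in the universe of V.
record Frame (V : Set ℓ) : Set (suc ℓ) where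
  field
    Member   : Pred (Valuation V) ℓ
    nonempty : Satisfiable Member

open Frame public

infix 4 _⊨_ _⊨*_ _⊢_

_⊨_ : {V : Set ℓ} → Frame V → SFormula V → Set ℓ
R ⊨ A ≺ Y = ∀ w → Member R w → ⟦ A ⟧ w ≡ false ⊎ w Y ≡ true
R ⊨ A ⊀ Y = ∃ λ w → Member R w × ⟦ A ⟧ w ≡ true × w Y ≡ false

_⊨*_ : {V : Set ℓ} → Frame V → Pred (SFormula V) ℓ → Set ℓ
R ⊨* Γ = ∀ φ → Γ φ → R ⊨ φ

Consistent : {V : Set ℓ} → Pred (SFormula V) ℓ → Set (suc ℓ)
Consistent {V = V} Γ = ∃ λ (R : Frame V) → R ⊨* Γ

data _⊢_ {V : Set ℓ} (Γ : Pred (SFormula V) ℓ) : SFormula V → Set ℓ where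
  premise : ∀ {φ} → Γ φ → Γ ⊢ φ
  I  : ∀ X → Γ ⊢ [ X ] ≺ X
  W  : ∀ {A Y} B → toList A ⊆ toList B → Γ ⊢ A ≺ Y → Γ ⊢ B ≺ Y
  HS : ∀ {A X Y} (B : List V) → Γ ⊢ (X ∷ B) ≺ Y → Γ ⊢ A ≺ X → Γ ⊢ (A ⁺++ B) ≺ Y
  N  : ∀ {A B X Z} → Γ ⊢ A ⊀ X → Γ ⊢ (A ⁺++ (Z ∷ [])) ≺ X →
       All (λ Y → Γ ⊢ A ≺ Y) B → Γ ⊢ B ⊀ Z

{-# OPTIONS --safe #-}

-- For a conjunction A let w_A be the valuation making exactly the Y with
-- Γ ⊢ A ≺ Y true. By (I), (W) and (HS) it satisfies all strict implications
-- in Γ and makes A true. Hence, if A ≺ Y is not derivable, the frame of all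
-- valuations satisfying the strict implications of Γ refutes it. If B ⊀ Z is
-- not derivable, keep only those valuations that do not witness B ⊀ Z: every
-- premise A ⊀ X is still witnessed, since unless A ∧ Z ≺ X is derivable
-- w_{A ∧ Z} is a witness, and if it is, then w_A is one: it makes X false by
-- consistency, and B false by (N).

module Submission where

open import Defs
open import Level using (Level)
open import Axiom.ExcludedMiddle using (ExcludedMiddle)
open import Relation.Unary using (Pred)

open import Data.Bool.Base using (true; false; _∧_)
open import Data.Bool.Properties using (∧-conicalˡ; ∧-conicalʳ; ¬-not; not-¬)
open import Data.List.Base using (List; []; _∷_; _++_)
open import Data.List.Membership.Propositional.Properties using (∈-++⁻)
open import Data.List.NonEmpty.Base using (_∷_; toList; _⁺++_)
import Data.List.NonEmpty.Relation.Unary.All as All⁺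
open import Data.List.Properties using (++-identityʳ)
open import Data.List.Relation.Binary.Subset.Propositional using (_⊆_)
open import Data.List.Relation.Binary.Subset.Propositional.Properties
  using (⊆-refl; ⊆-reflexive; ⊆-reflexive-↭; xs⊆xs++ys; xs⊆ys++xs; ∈-∷⁺ʳ; All-resp-⊇)
open import Data.List.Relation.Binary.Permutation.Propositional.Properties using (shift)
open import Data.List.Relation.Unary.All as All using (All; []; _∷_)
open import Data.List.Relation.Unary.All.Properties using (++⁻ˡ; ++⁻ʳ)
open import Data.Product.Base using (_×_; _,_)
open import Data.Sum.Base using (_⊎_; inj₁; inj₂; [_,_]′)
open import Function.Base using (_∘_)
open import Relation.Binary.PropositionalEquality
  using (_≡_; refl; cong₂)
open import Relation.Nullary using (¬_; Dec; yes; no; does; contradiction)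
open import Relation.Nullary.Decidable using (dec-true; dec-false; decidable-stable)

++⊆ : ∀ {a} {A : Set a} {xs ys zs : List A} → xs ⊆ zs → ys ⊆ zs → xs ++ ys ⊆ zs
++⊆ {xs = xs} xs⊆zs ys⊆zs = [ xs⊆zs , ys⊆zs ]′ ∘ ∈-++⁻ xs

does-true⁻ : ∀ {p} {P : Set p} (P? : Dec P) → does P? ≡ true → P
does-true⁻ (yes p) _ = p

module _ {ℓ : Level} {V : Set ℓ} where

  AllTrue : Valuation V → List V → Set ℓ
  AllTrue w = All (λ X → w X ≡ true)

  ⟦⟧-true⁻ : ∀ w A → ⟦ A ⟧ w ≡ true → AllTrue w (toList A)
  ⟦⟧-true⁻ w (X ∷ Xs) = go X Xs
    where
    go : ∀ X Xs → ⟦ X ∷ Xs ⟧ w ≡ true → AllTrue w (X ∷ Xs)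
    go X []       eq = eq ∷ []
    go X (Y ∷ Ys) eq = ∧-conicalˡ _ _ eq ∷ go Y Ys (∧-conicalʳ (w X) _ eq)

  ⟦⟧-true⁺ : ∀ w A → AllTrue w (toList A) → ⟦ A ⟧ w ≡ true
  ⟦⟧-true⁺ w (X ∷ [])     (eq ∷ []) = eq
  ⟦⟧-true⁺ w (X ∷ Y ∷ Ys) (eq ∷ eqs) =
    cong₂ _∧_ eq (⟦⟧-true⁺ w (Y ∷ Ys) eqs)

  infix 4 _⊩_≺_

  -- The clause of `R ⊨ A ≺ Y` at a single valuation, stated so that both agree by definition;
  -- `⊩-mp` and `⊩-intro` then let it be used as an implication.
  _⊩_≺_ : Valuation V → Conj V → V → Set
  w ⊩ A ≺ Y = ⟦ A ⟧ w ≡ false ⊎ w Y ≡ true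

  ⊩-mp : ∀ {w A Y} → w ⊩ A ≺ Y → AllTrue w (toList A) → w Y ≡ true
  ⊩-mp (inj₁ A-false) A-true =
    contradiction A-false (not-¬ (⟦⟧-true⁺ _ _ A-true))
  ⊩-mp (inj₂ Y-true)  _      = Y-true

  ⊩-intro : ∀ {w Y} A → (AllTrue w (toList A) → w Y ≡ true) → w ⊩ A ≺ Y
  ⊩-intro {w} A f with ⟦ A ⟧ w in eq
  ... | false = inj₁ refl
  ... | true  = inj₂ (f (⟦⟧-true⁻ w A eq))

  module _ (Γ : Pred (SFormula V) ℓ) where

    Model : Pred (Valuation V) ℓ
    Model w = ∀ A Y → Γ (A ≺ Y) → w ⊩ A ≺ Y

    -- Rules concluding a strict implication have only strict implications as premises, so the
    -- recursion never meets (N) and stays at one valuation.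
    sound-≺ : ∀ {w A Y} → Model w → Γ ⊢ A ≺ Y →
              AllTrue w (toList A) → w Y ≡ true
    sound-≺ w-model (premise γ) A-true = ⊩-mp (w-model _ _ γ) A-true
    sound-≺ w-model (I X) (X-true ∷ []) = X-true
    sound-≺ w-model (W B A⊆B d) B-true =
      sound-≺ w-model d (All-resp-⊇ A⊆B B-true)
    sound-≺ w-model (HS {A} B d e) AB-true =
      sound-≺ w-model d
        (sound-≺ w-model e (++⁻ˡ (toList A) AB-true) ∷ ++⁻ʳ (toList A) AB-true)

    ⊢-refl : ∀ A → All (λ X → Γ ⊢ A ≺ X) (toList A)
    ⊢-refl A = All.tabulate λ X∈A → W A (∈-∷⁺ʳ X∈A λ ()) (I _)

    -- (HS) replaces one conjunct at a time. Keeping `A` in the antecedent throughout makes the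
    -- induction on `Xs` go through: each use of (HS) adds a second copy of `A`, which (W)
    -- contracts.
    cut-++ : ∀ {A Y} Xs → All (λ X → Γ ⊢ A ≺ X) Xs →
             Γ ⊢ (A ⁺++ Xs) ≺ Y → Γ ⊢ A ≺ Y
    cut-++ {A} [] [] d = W A (⊆-reflexive (++-identityʳ (toList A))) d
    cut-++ {A} {Y} (X ∷ Xs) (e ∷ es) d =
      cut-++ Xs es (W (A ⁺++ Xs) duplicates (HS (toList A ++ Xs) X-first e))
      where
      X-first : Γ ⊢ (X ∷ (toList A ++ Xs)) ≺ Y
      X-first = W _ (⊆-reflexive-↭ (shift X (toList A) Xs)) d

      duplicates : toList A ++ (toList A ++ Xs) ⊆ toList A ++ Xs
      duplicates = ++⊆ (xs⊆xs++ys (toList A) Xs) ⊆-refl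

    cut : ∀ {A B Y} → All (λ X → Γ ⊢ A ≺ X) (toList B) → Γ ⊢ B ≺ Y → Γ ⊢ A ≺ Y
    cut {A} {B} es d = cut-++ (toList B) es (W _ (xs⊆ys++xs _ (toList A)) d)

    module _ (em : ExcludedMiddle ℓ) where

      canonical : Conj V → Valuation V
      canonical A X = does (em {Γ ⊢ A ≺ X})

      canonical⁻ : ∀ {A Xs} → AllTrue (canonical A) Xs → All (λ X → Γ ⊢ A ≺ X) Xs
      canonical⁻ = All.map (does-true⁻ em)

      canonical-model : ∀ A → Model (canonical A)
      canonical-model A B Y γ =
        ⊩-intro B λ B-true → dec-true em (cut (canonical⁻ B-true) (premise γ))

      canonical-self : ∀ A → AllTrue (canonical A) (toList A)
      canonical-self A = All.map (dec-true em) (⊢-refl A)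

      complete-≺ : ∀ {A Y} → Consistent Γ →
                   ((R : Frame V) → R ⊨* Γ → R ⊨ A ≺ Y) → Γ ⊢ A ≺ Y
      complete-≺ {A} (R , R⊨Γ) valid =
        does-true⁻ em
          (⊩-mp (valid models models⊨Γ (canonical A) (canonical-model A))
                (canonical-self A))
        where
        models : Frame V
        models .Member   = Model
        models .nonempty = canonical A , canonical-model A

        models⊨Γ : models ⊨* Γ
        models⊨Γ (B ≺ Y) γ w w-model = w-model B Y γ
        -- The witness comes from the frame `R` given by consistency, whose members all lie in
        -- `Model`.
        models⊨Γ (B ⊀ Y) γ =
          let w , w∈R , eqs = R⊨Γ _ γ in
          w , (λ C Z δ → R⊨Γ _ δ w w∈R) , eqs

      complete-⊀ : ∀ {B Z} → Consistent Γ →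
                   ((R : Frame V) → R ⊨* Γ → R ⊨ B ⊀ Z) → Γ ⊢ B ⊀ Z
      complete-⊀ {B} {Z} (R , R⊨Γ) valid = decidable-stable em λ underivable →
        let w , (_ , w⊩B≺Z) , B-true , Z-false =
              valid nonwitnesses (nonwitnesses⊨Γ underivable)
        in not-¬ (⊩-mp w⊩B≺Z (⟦⟧-true⁻ w B B-true)) Z-false
        where
        nonwitnesses : Frame V
        nonwitnesses .Member w = Model w × w ⊩ B ≺ Z
        -- The all-true valuation falsifies no consequent.
        nonwitnesses .nonempty = (λ _ → true) , (λ _ _ _ → inj₂ refl) , inj₂ refl

        -- Soundness is applied at the member of `R` that witnesses `A ⊀ X`.
        underivable-≺ : ∀ {A X} → Γ (A ⊀ X) → ¬ (Γ ⊢ A ≺ X)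
        underivable-≺ γ d =
          let w , w∈R , A-true , X-false = R⊨Γ _ γ in
          not-¬ (sound-≺ (λ _ _ δ → R⊨Γ _ δ w w∈R) d (⟦⟧-true⁻ w _ A-true)) X-false

        nonwitnesses⊨Γ : ¬ (Γ ⊢ B ⊀ Z) → nonwitnesses ⊨* Γ
        nonwitnesses⊨Γ _ (A ≺ X) γ w (w-model , _) = w-model A X γ
        nonwitnesses⊨Γ underivable (A ⊀ X) γ with em {Γ ⊢ (A ⁺++ (Z ∷ [])) ≺ X}
        -- `Z` is a conjunct of `AZ`, hence true at `canonical AZ`, which therefore cannot witness
        -- `B ⊀ Z`.
        ... | no ¬AZ≺X =
          canonical AZ ,
          (canonical-model AZ , inj₂ (All.head (++⁻ʳ (toList A) (canonical-self AZ)))) ,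
          ⟦⟧-true⁺ _ A (++⁻ˡ (toList A) (canonical-self AZ)) ,
          dec-false em ¬AZ≺X
          where
          AZ : Conj V
          AZ = A ⁺++ (Z ∷ [])
        -- If `B` were true at `canonical A`, every conjunct of `B` would be derivable from `A`,
        -- which is the last premise that (N) requires.
        ... | yes AZ≺X =
          canonical A ,
          (canonical-model A , inj₁ (¬-not λ B-true →
            underivable (N (premise γ) AZ≺X
              (fromList⁺ (canonical⁻ (⟦⟧-true⁻ _ B B-true)))))) ,
          ⟦⟧-true⁺ _ A (canonical-self A) ,
          dec-false em (underivable-≺ γ)
          where
          fromList⁺ : ∀ {P : Pred V ℓ} {C} → All P (toList C) → All⁺.All P C
          fromList⁺ (p ∷ ps) = p All⁺.∷ ps

theorem17 : ∀ {ℓ : Level} → ExcludedMiddle ℓ →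
    (V : Set ℓ) → Infinite V →
    (Γ : Pred (SFormula V) ℓ) → Consistent Γ →
    (φ : SFormula V) →
    ((R : Frame V) → R ⊨* Γ → R ⊨ φ) →
    Γ ⊢ φ
theorem17 em V _ Γ consistent (A ≺ Y) valid = complete-≺ Γ em consistent valid
theorem17 em V _ Γ consistent (B ⊀ Z) valid = complete-⊀ Γ em consistent valid
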